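{- Let $G=(V,E)$ be a bipartite graph with $B$ butterflies and with $\wedge=\sum_{u\in V}\binom{d_u}{2}>0$ wedges. Let $Y$ be the return value of one iteration of the algorithm WSamp: choose a vertex $u\in V$ with probability $\binom{d_u}{2}/\wedge$, choose two distinct vertices $v,w\in\Gamma_u$ uniformly at random, set $\beta=|\Gamma_v\cap\Gamma_w|-1$, and return $Y=\beta\cdot\wedge/4$. Then $\mathbb{E}[Y]=B$.
   Context: Graphs are finite, simple, bipartite. $\Gamma_v$ is the set of neighbors of $v$, $d_v=|\Gamma_v|$. A wedge is a path of length two. A butterfly is a $2\times2$ biclique (two vertices on each side of the bipartition, all four edges between them present). $B=B(G)$ is the number of butterflies in $G$. -}

module Defs where

open import Data.Bool.Base using (Bool; true; false)
import Data.Bool.Properties as Bool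
open import Data.Fin.Base as Fin using (Fin; zero; suc)
import Data.Fin.Properties as Fin
open import Data.Fin.Subset using (Subset; _∈_; _∩_; ∣_∣; inside; outside)
open import Data.Fin.Subset.Properties using (_∈?_)
open import Data.Integer.Base as ℤ using (+_; 1ℤ)
import Data.Integer.Properties as ℤ
open import Data.List.Base
  using (List; []; _∷_; _++_; map; concatMap; filter; length; foldr; allFin; cartesianProduct)
open import Data.List.Membership.Propositional using () renaming (_∈_ to _∈ₗ_)
open import Data.List.Membership.Propositional.Properties
  using (∈-filter⁺; ∈-cartesianProduct⁺; ∈-allFin)
open import Data.List.Relation.Unary.All using (All; []; _∷_)
import Data.List.Relation.Unary.All.Properties as All
open import Data.List.Relation.Unary.Any using (here; there)
open import Data.Nat.Base as ℕ using (ℕ; _>_; NonZero; z≤n; s≤s; z<s; >-nonZero)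
open import Data.Nat.ListAction using (sum)
open import Data.Nat.Combinatorics using (_C_)
import Data.Nat.Properties as ℕ
open import Data.Product.Base using (∃; _×_; _,_; proj₁; proj₂)
open import Data.Rational.Base using (ℚ; 0ℚ; 1ℚ; _+_; _*_; _/_; NonNegative; toℚᵘ)
import Data.Rational.Properties as ℚ
import Data.Rational.Unnormalised.Base as ℚᵘ
import Data.Rational.Unnormalised.Properties as ℚᵘ
open import Data.Vec.Base using (tabulate; []; _∷_; here; there)
open import Level using (0ℓ)
open import Relation.Binary.Core using (Rel)
open import Relation.Binary.Definitions using (Decidable; Symmetric)
open import Relation.Binary.PropositionalEquality
  using (_≡_; _≢_; refl; sym; trans; cong; cong₂; module ≡-Reasoning)
open import Relation.Nullary.Decidable using (Dec; does; yes; no; _×-dec_; ¬?)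
open import Relation.Nullary.Negation using (contradiction)

private
  variable
    A B : Set
    n : ℕ

sumℚ : List ℚ → ℚ
sumℚ = foldr _+_ 0ℚ

mass : List (A × ℚ) → ℚ
mass xs = sumℚ (map proj₂ xs)

NonNegWeights : List (A × ℚ) → Set
NonNegWeights = All (λ (_ , p) → NonNegative p)

-- A list of outcomes with their probabilities; an outcome may be listed
-- several times, in which case its probabilities add up.
record Dist (A : Set) : Set where
  constructor mkDist
  field
    outcomes : List (A × ℚ)
    nonNeg   : NonNegWeights outcomes
    total    : mass outcomes ≡ 1ℚ

open Dist public

𝔼 : Dist ℚ → ℚ
𝔼 d = sumℚ (map (λ (y , p) → p * y) (outcomes d))

return : A → Dist A
return a = mkDist ((a , 1ℚ) ∷ []) (_ ∷ []) refl

private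
  mass-++ : (xs ys : List (A × ℚ)) → mass (xs ++ ys) ≡ mass xs + mass ys
  mass-++ []             ys = sym (ℚ.+-identityˡ (mass ys))
  mass-++ ((_ , p) ∷ xs) ys =
    trans (cong (λ t → p + t) (mass-++ xs ys)) (sym (ℚ.+-assoc p (mass xs) (mass ys)))

scale : ℚ → List (A × ℚ) → List (A × ℚ)
scale p = map (λ (b , q) → b , p * q)

bindOutcomes : List (A × ℚ) → (A → Dist B) → List (B × ℚ)
bindOutcomes xs k = concatMap (λ (a , p) → scale p (outcomes (k a))) xs

private
  mass-scale : ∀ p (xs : List (A × ℚ)) → mass (scale p xs) ≡ p * mass xs
  mass-scale p []             = sym (ℚ.*-zeroʳ p)
  mass-scale p ((_ , q) ∷ xs) =
    trans (cong (λ t → p * q + t) (mass-scale p xs)) (sym (ℚ.*-distribˡ-+ p q (mass xs)))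

  mass-bind : (xs : List (A × ℚ)) (k : A → Dist B) → mass (bindOutcomes xs k) ≡ mass xs
  mass-bind []             k = refl
  mass-bind ((a , p) ∷ xs) k = begin
    mass (scale p (outcomes (k a)) ++ bindOutcomes xs k)
      ≡⟨ mass-++ (scale p (outcomes (k a))) (bindOutcomes xs k) ⟩
    mass (scale p (outcomes (k a))) + mass (bindOutcomes xs k)
      ≡⟨ cong₂ _+_ (mass-scale p (outcomes (k a))) (mass-bind xs k) ⟩
    p * mass (outcomes (k a)) + mass xs
      ≡⟨ cong (λ t → p * t + mass xs) (total (k a)) ⟩
    p * 1ℚ + mass xs
      ≡⟨ cong (_+ mass xs) (ℚ.*-identityʳ p) ⟩
    p + mass xs ∎
    where open ≡-Reasoning

  nonNeg-scale : ∀ p → NonNegative p → {xs : List (B × ℚ)} →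
                 NonNegWeights xs →
                 NonNegWeights (scale p xs)
  nonNeg-scale p p≥0 []           = []
  nonNeg-scale p p≥0 (q≥0 ∷ qs≥0) =
    ℚ.nonNeg*nonNeg⇒nonNeg p {{p≥0}} _ {{q≥0}} ∷ nonNeg-scale p p≥0 qs≥0

  nonNeg-bind : {xs : List (A × ℚ)} → NonNegWeights xs →
                (k : A → Dist B) →
                NonNegWeights (bindOutcomes xs k)
  nonNeg-bind []                              k = []
  nonNeg-bind {xs = (a , p) ∷ _} (p≥0 ∷ ps≥0) k =
    All.++⁺ (nonNeg-scale p p≥0 (nonNeg (k a))) (nonNeg-bind ps≥0 k)

infixl 1 _>>=_

_>>=_ : Dist A → (A → Dist B) → Dist B
d >>= k = mkDist (bindOutcomes (outcomes d) k)
                 (nonNeg-bind (nonNeg d) k)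
                 (trans (mass-bind (outcomes d) k) (total d))

normaliseBy : (N : ℕ) .{{_ : NonZero N}} → List (A × ℕ) → List (A × ℚ)
normaliseBy N = map (λ (a , k) → a , + k / N)

private
  /-+ : ∀ a b N .{{_ : NonZero N}} → (+ a / N) + (+ b / N) ≡ + (a ℕ.+ b) / N
  /-+ a b N@(ℕ.suc N-1) = ℚ.toℚᵘ-injective (begin
    toℚᵘ ((+ a / N) + (+ b / N))
      ≈⟨ ℚ.toℚᵘ-homo-+ (+ a / N) (+ b / N) ⟩
    toℚᵘ (+ a / N) ℚᵘ.+ toℚᵘ (+ b / N)
      ≈⟨ ℚᵘ.+-cong (ℚ.toℚᵘ-fromℚᵘ (ℚᵘ.mkℚᵘ (+ a) N-1)) (ℚ.toℚᵘ-fromℚᵘ (ℚᵘ.mkℚᵘ (+ b) N-1)) ⟩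
    ℚᵘ.mkℚᵘ (+ a) N-1 ℚᵘ.+ ℚᵘ.mkℚᵘ (+ b) N-1
      ≈⟨ ℚᵘ.*≡* (trans (cong (ℤ._* + N) (sym (ℤ.*-distribʳ-+ (+ N) (+ a) (+ b))))
                       (ℤ.*-assoc (+ a ℤ.+ + b) (+ N) (+ N))) ⟩
    ℚᵘ.mkℚᵘ (+ (a ℕ.+ b)) N-1
      ≈⟨ ℚᵘ.≃-sym (ℚ.toℚᵘ-fromℚᵘ (ℚᵘ.mkℚᵘ (+ (a ℕ.+ b)) N-1)) ⟩
    toℚᵘ (+ (a ℕ.+ b) / N) ∎)
    where open import Relation.Binary.Reasoning.Setoid ℚᵘ.≃-setoid

  mass-normaliseBy : ∀ N .{{_ : NonZero N}} (xs : List (A × ℕ)) →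
                     mass (normaliseBy N xs) ≡ + sum (map proj₂ xs) / N
  mass-normaliseBy N []             = sym (ℚ.0/n≡0 N)
  mass-normaliseBy N ((_ , k) ∷ xs) =
    trans (cong (λ t → (+ k / N) + t) (mass-normaliseBy N xs)) (/-+ k (sum (map proj₂ xs)) N)

  n/n≡1 : ∀ N .{{_ : NonZero N}} → + N / N ≡ 1ℚ
  n/n≡1 N@(ℕ.suc _) = ℚ.fromℚᵘ-cong {ℚᵘ.mkℚᵘ (+ N) _} {ℚᵘ.1ℚᵘ} (ℚᵘ.*≡* (ℤ.*-comm (+ N) 1ℤ))

  nonNeg-normaliseBy : ∀ N .{{_ : NonZero N}} (xs : List (A × ℕ)) →
                       NonNegWeights (normaliseBy N xs)
  nonNeg-normaliseBy N []             = []
  nonNeg-normaliseBy N ((_ , k) ∷ xs) = ℚ.normalize-nonNeg k N ∷ nonNeg-normaliseBy N xs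

fromWeights : (N : ℕ) .{{_ : NonZero N}} (xs : List (A × ℕ)) →
              sum (map proj₂ xs) ≡ N → Dist A
fromWeights N xs sum≡N = mkDist (normaliseBy N xs) (nonNeg-normaliseBy N xs)
  (trans (mass-normaliseBy N xs) (trans (cong (λ s → + s / N) sum≡N) (n/n≡1 N)))

support : (w : A → ℕ) → List A → List ((∃ λ a → w a > 0) × ℕ)
support w []       = []
support w (a ∷ as) with w a ℕ.>? 0
... | yes wa>0 = ((a , wa>0) , w a) ∷ support w as
... | no  _    = support w as

private
  sum-support : (w : A → ℕ) (as : List A) →
                sum (map proj₂ (support w as)) ≡ sum (map w as)
  sum-support w []       = refl
  sum-support w (a ∷ as) with w a ℕ.>? 0
  ... | yes _    = cong (λ t → w a ℕ.+ t) (sum-support w as)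
  ... | no  wa≯0 = trans (sum-support w as)
                         (cong (ℕ._+ sum (map w as)) (sym (ℕ.n≤0⇒n≡0 (ℕ.≮⇒≥ wa≯0))))

  sum-ones : (as : List A) → sum (map proj₂ (map (_, 1) as)) ≡ length as
  sum-ones []       = refl
  sum-ones (_ ∷ as) = cong ℕ.suc (sum-ones as)

-- Choose a with probability w a / Σ w.  Outcomes of probability 0 are left
-- out, so the continuation may rely on w a > 0.
weighted : (w : A → ℕ) (as : List A) → sum (map w as) > 0 → Dist (∃ λ a → w a > 0)
weighted w as pos =
  fromWeights (sum (map w as)) {{>-nonZero pos}} (support w as) (sum-support w as)

uniform : (as : List A) → length as > 0 → Dist A
uniform as pos = fromWeights (length as) {{>-nonZero pos}} (map (_, 1) as) (sum-ones as)

vertexPairs : (n : ℕ) → List (Fin n × Fin n)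
vertexPairs n = cartesianProduct (allFin n) (allFin n)

-- Loops are excluded by `proper`.
record BipartiteGraph (n : ℕ) : Set₁ where
  field
    Adj     : Rel (Fin n) 0ℓ
    adj?    : Decidable Adj
    adj-sym : Symmetric Adj
    side    : Fin n → Bool
    proper  : ∀ {u v} → Adj u v → side u ≢ side v

module _ (G : BipartiteGraph n) where
  open BipartiteGraph G

  Γ : Fin n → Subset n
  Γ v = tabulate (λ w → does (adj? v w))

  deg : Fin n → ℕ
  deg v = ∣ Γ v ∣

  wedgesAt : Fin n → ℕ
  wedgesAt u = deg u C 2

  wedges : ℕ
  wedges = sum (map wedgesAt (allFin n))

  -- The strict inequalities list each unordered pair of vertices once.
  IsButterfly : (Fin n × Fin n) × (Fin n × Fin n) → Set
  IsButterfly ((l , l′) , (r , r′)) =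
    (l Fin.< l′ × side l ≡ true  × side l′ ≡ true) ×
    (r Fin.< r′ × side r ≡ false × side r′ ≡ false) ×
    (Adj l r × Adj l r′ × Adj l′ r × Adj l′ r′)

  isButterfly? : ∀ q → Dec (IsButterfly q)
  isButterfly? ((l , l′) , (r , r′)) =
    (l Fin.<? l′ ×-dec side l Bool.≟ true  ×-dec side l′ Bool.≟ true) ×-dec
    (r Fin.<? r′ ×-dec side r Bool.≟ false ×-dec side r′ Bool.≟ false) ×-dec
    (adj? l r ×-dec adj? l r′ ×-dec adj? l′ r ×-dec adj? l′ r′)

  #butterflies : ℕ
  #butterflies = length (filter isButterfly? (cartesianProduct (vertexPairs n) (vertexPairs n)))

DistinctIn : Subset n → Fin n × Fin n → Set
DistinctIn S (v , w) = v ∈ S × w ∈ S × v ≢ w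

distinctIn? : (S : Subset n) → ∀ vw → Dec (DistinctIn S vw)
distinctIn? S (v , w) = v ∈? S ×-dec w ∈? S ×-dec ¬? (v Fin.≟ w)

distinctPairs : Subset n → List (Fin n × Fin n)
distinctPairs {n} S = filter (distinctIn? S) (vertexPairs n)

private
  ∃-∈ : (S : Subset n) → ∣ S ∣ > 0 → ∃ (_∈ S)
  ∃-∈ (inside  ∷ S) _   = zero , here
  ∃-∈ (outside ∷ S) pos with v , v∈S ← ∃-∈ S pos = suc v , there v∈S

  ∃-distinct : (S : Subset n) → ∣ S ∣ > 1 → ∃ (DistinctIn S)
  ∃-distinct (inside ∷ S) (s≤s pos) with v , v∈S ← ∃-∈ S pos =
    (zero , suc v) , here , there v∈S , λ ()
  ∃-distinct (outside ∷ S) >1 with (v , w) , v∈S , w∈S , v≢w ← ∃-distinct S >1 =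
    (suc v , suc w) , there v∈S , there w∈S , λ where refl → v≢w refl

  C2>0⇒>1 : ∀ d → d C 2 > 0 → d > 1
  C2>0⇒>1 (ℕ.suc (ℕ.suc _)) _ = s≤s (s≤s z≤n)

  ∈⇒length>0 : {a : A} {as : List A} → a ∈ₗ as → length as > 0
  ∈⇒length>0 (here  _) = z<s
  ∈⇒length>0 (there _) = z<s

distinctPairs>0 : (S : Subset n) → ∣ S ∣ C 2 > 0 → length (distinctPairs S) > 0
distinctPairs>0 S pos with (v , w) , dist ← ∃-distinct S (C2>0⇒>1 ∣ S ∣ pos) =
  ∈⇒length>0 (∈-filter⁺ (distinctIn? S) (∈-cartesianProduct⁺ (∈-allFin v) (∈-allFin w)) dist)

WSamp : (G : BipartiteGraph n) → wedges G > 0 → Dist ℚ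
WSamp {n} G wedges>0 = do
  u , wedgesAt>0 ← weighted (wedgesAt G) (allFin n) wedges>0
  v , w ← uniform (distinctPairs (Γ G u)) (distinctPairs>0 (Γ G u) wedgesAt>0)
  let β = + ∣ Γ G v ∩ Γ G w ∣ ℤ.- 1ℤ
  return ((β ℤ.* + wedges G) / 4)

{-# OPTIONS --safe #-}

-- A vertex u and an ordered pair (v , w) of distinct neighbours of u contribute
-- (C(d_u,2)/∧) · (1/(2 C(d_u,2))) · β ∧/4 = β/8 to the expectation.
-- Exchanging the sum over u with the sum over (v , w) turns the total of the β's
-- into Σ_{v≠w} c (c − 1) with c = |Γ_v ∩ Γ_w|, the number of (v , w , x , y) with
-- v ≠ w, x ≠ y and all four edges present.  Each butterfly is counted 8 times
-- there: twice for the order of each of the two pairs, and twice for which of the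
-- two pairs lies on the left.
module Submission where

open import Defs
import Algebra.Properties.Semiring.Sum as SemiringSum
open import Data.Bool.Base using (Bool; true; false; not; _∧_)
import Data.Bool.Properties as Bool
open import Data.Fin.Base using (Fin; zero; suc)
import Data.Fin.Properties as Fin
open import Data.Fin.Subset using (Subset; _∈_; _∩_; ∣_∣; inside; outside)
open import Data.Fin.Subset.Properties
  using (_∈?_; x∈p∩q⁺; x∈p∩q⁻; x∈⁅y⁆⇒x≡y; p⊆q⇒∣p∣≤∣q∣; ∣⁅x⁆∣≡1)
open import Data.Integer.Base as ℤ using (+_; 1ℤ)
import Data.Integer.Properties as ℤ
import Data.Integer.Tactic.RingSolver as ℤSolver
open import Data.List.Base
  using (List; []; _∷_; _++_; map; filter; length; allFin; tabulate; cartesianProduct)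
open import Data.List.Properties using (map-++; map-∘)
open import Data.List.Relation.Unary.All as All using (All; []; _∷_)
open import Data.List.Relation.Unary.All.Properties using (all-filter)
open import Data.Nat.Base as ℕ using (ℕ; zero; suc; _>_; _∸_; NonZero; >-nonZero)
open import Data.Nat.Combinatorics using (_C_; nC1≡n; nCk+nC[k+1]≡[n+1]C[k+1])
open import Data.Nat.ListAction using (sum)
open import Data.Nat.ListAction.Properties using (sum-++)
import Data.Nat.Properties as ℕ
import Data.Nat.Tactic.RingSolver as ℕSolver
open import Data.Product.Base using (∃; _×_; _,_; uncurry)
open import Data.Rational.Base using (ℚ; 1ℚ; _+_; _*_; _/_; toℚᵘ)
import Data.Rational.Properties as ℚ
import Data.Rational.Unnormalised.Base as ℚᵘ
import Data.Rational.Unnormalised.Properties as ℚᵘ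
import Data.Vec.Base as Vec
open import Function.Base using (_∘_)
open import Function.Bundles using (mk⇔)
open import Level using (0ℓ)
open import Relation.Binary.Definitions using (tri<; tri≈; tri>)
open import Relation.Binary.PropositionalEquality
  using (_≡_; _≢_; refl; sym; trans; cong; cong₂; subst; module ≡-Reasoning)
open import Relation.Nullary.Decidable
  using (Dec; does; yes; no; _×-dec_; does-⇔; dec-true; dec-false)
open import Relation.Nullary.Negation using (contradiction)
open import Relation.Unary using (Pred; Decidable)

open SemiringSum ℕ.+-*-semiring
  using (sum-syntax; sum-cong-≗; ∑-distrib-+; ∑-comm; *-distribˡ-sum; *-distribʳ-sum)
open ≡-Reasoning

private
  variable
    A B : Set
    n : ℕ

-- Indicators and sums

𝟙 : Bool → ℕ
𝟙 true  = 1
𝟙 false = 0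

𝟙-∧ : ∀ a b → 𝟙 (a ∧ b) ≡ 𝟙 a ℕ.* 𝟙 b
𝟙-∧ true  b = sym (ℕ.+-identityʳ (𝟙 b))
𝟙-∧ false b = refl

-- This is the shape of the condition on each pair in `isButterfly?`: one order test and two side
-- tests, followed by everything else.
𝟙-∧₃ : ∀ a b c d → 𝟙 ((a ∧ b ∧ c) ∧ d) ≡ 𝟙 a ℕ.* 𝟙 b ℕ.* 𝟙 c ℕ.* 𝟙 d
𝟙-∧₃ true  true  true  d = sym (ℕ.+-identityʳ (𝟙 d))
𝟙-∧₃ true  true  false d = refl
𝟙-∧₃ true  false c     d = refl
𝟙-∧₃ false b     c     d = refl

sum-map-tabulate : (f : A → ℕ) (g : Fin n → A) →
                   sum (map f (tabulate g)) ≡ ∑[ i < n ] f (g i)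
sum-map-tabulate {n = zero}  f g = refl
sum-map-tabulate {n = suc n} f g = cong (f (g zero) ℕ.+_) (sum-map-tabulate f (g ∘ suc))

sum-cartesianProduct : (f : A × B → ℕ) (xs : List A) (ys : List B) →
                       sum (map f (cartesianProduct xs ys)) ≡
                       sum (map (λ x → sum (map (λ y → f (x , y)) ys)) xs)
sum-cartesianProduct f []       ys = refl
sum-cartesianProduct f (x ∷ xs) ys = begin
  sum (map f (map (x ,_) ys ++ cartesianProduct xs ys))
    ≡⟨ cong sum (map-++ f (map (x ,_) ys) (cartesianProduct xs ys)) ⟩
  sum (map f (map (x ,_) ys) ++ map f (cartesianProduct xs ys))
    ≡⟨ sum-++ (map f (map (x ,_) ys)) (map f (cartesianProduct xs ys)) ⟩
  sum (map f (map (x ,_) ys)) ℕ.+ sum (map f (cartesianProduct xs ys))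
    ≡⟨ cong₂ ℕ._+_ (cong sum (sym (map-∘ ys))) (sum-cartesianProduct f xs ys) ⟩
  sum (map (λ y → f (x , y)) ys) ℕ.+ sum (map (λ x → sum (map (λ y → f (x , y)) ys)) xs) ∎

sum-filter : {P : Pred A 0ℓ} (P? : Decidable P) (f : A → ℕ) (xs : List A) →
             sum (map f (filter P? xs)) ≡ sum (map (λ x → 𝟙 (does (P? x)) ℕ.* f x) xs)
sum-filter P? f []       = refl
sum-filter P? f (x ∷ xs) with does (P? x)
... | true  = cong₂ ℕ._+_ (sym (ℕ.+-identityʳ (f x))) (sum-filter P? f xs)
... | false = sum-filter P? f xs

length-filter : {P : Pred A 0ℓ} (P? : Decidable P) (xs : List A) →
                length (filter P? xs) ≡ sum (map (λ x → 𝟙 (does (P? x))) xs)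
length-filter P? []       = refl
length-filter P? (x ∷ xs) with does (P? x)
... | true  = cong suc (length-filter P? xs)
... | false = length-filter P? xs

-- Double sums and their restriction to distinct or increasing indices.

∑² : (Fin n → Fin n → ℕ) → ℕ
∑² {n} f = ∑[ i < n ] ∑[ j < n ] f i j

∑²-cong : {f g : Fin n → Fin n → ℕ} → (∀ i j → f i j ≡ g i j) → ∑² f ≡ ∑² g
∑²-cong f≗g = sum-cong-≗ (λ i → sum-cong-≗ (f≗g i))

∑²-distrib-+ : (f g : Fin n → Fin n → ℕ) → ∑² (λ i j → f i j ℕ.+ g i j) ≡ ∑² f ℕ.+ ∑² g
∑²-distrib-+ f g = trans (sum-cong-≗ (λ i → ∑-distrib-+ (f i) (g i)))
  (∑-distrib-+ (λ i → ∑[ j < _ ] f i j) (λ i → ∑[ j < _ ] g i j))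

*-distribˡ-∑² : ∀ k (f : Fin n → Fin n → ℕ) → k ℕ.* ∑² f ≡ ∑² (λ i j → k ℕ.* f i j)
*-distribˡ-∑² k f = trans (*-distribˡ-sum k (λ i → ∑[ j < _ ] f i j))
  (sum-cong-≗ (λ i → *-distribˡ-sum k (f i)))

∑²-∑-comm : (f : Fin n → Fin n → Fin n → ℕ) →
            ∑[ k < n ] ∑² (f k) ≡ ∑² (λ i j → ∑[ k < n ] f k i j)
∑²-∑-comm f = trans (∑-comm (λ k i → ∑[ j < _ ] f k i j))
  (sum-cong-≗ (λ i → ∑-comm (λ k j → f k i j)))

∑²-comm : (f : Fin n → Fin n → Fin n → Fin n → ℕ) →
          ∑² (λ i j → ∑² (f i j)) ≡ ∑² (λ k l → ∑² (λ i j → f i j k l))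
∑²-comm f = begin
  ∑² (λ i j → ∑² (f i j))
    ≡⟨ sum-cong-≗ (λ i → ∑²-∑-comm (f i)) ⟩
  ∑[ i < _ ] ∑² (λ k l → ∑[ j < _ ] f i j k l)
    ≡⟨ ∑²-∑-comm (λ i k l → ∑[ j < _ ] f i j k l) ⟩
  ∑² (λ k l → ∑² (λ i j → f i j k l)) ∎

sum-vertexPairs : (f : Fin n × Fin n → ℕ) →
                  sum (map f (vertexPairs n)) ≡ ∑² (λ i j → f (i , j))
sum-vertexPairs {n} f = begin
  sum (map f (vertexPairs n))
    ≡⟨ sum-cartesianProduct f (allFin n) (allFin n) ⟩
  sum (map (λ i → sum (map (λ j → f (i , j)) (allFin n))) (allFin n))
    ≡⟨ sum-map-tabulate (λ i → sum (map (λ j → f (i , j)) (allFin n))) (λ i → i) ⟩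
  (∑[ i < n ] sum (map (λ j → f (i , j)) (allFin n)))
    ≡⟨ sum-cong-≗ {n} (λ i → sum-map-tabulate (λ j → f (i , j)) (λ j → j)) ⟩
  ∑² (λ i j → f (i , j)) ∎

-- The values lie in `ℕ` rather than `Bool`, so that restricting a sum to such pairs is
-- multiplication by a factor.
_≢ᵇ_ _<ᵇ_ : Fin n → Fin n → ℕ
i ≢ᵇ j = 𝟙 (not (does (i Fin.≟ j)))
i <ᵇ j = 𝟙 (does (i Fin.<? j))

≢ᵇ-split : (i j : Fin n) → i ≢ᵇ j ≡ (i <ᵇ j) ℕ.+ (j <ᵇ i)
≢ᵇ-split i j with Fin.<-cmp i j
... | tri< i<j i≢j i≯j rewrite dec-false (i Fin.≟ j) i≢j | dec-true (i Fin.<? j) i<j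
                             | dec-false (j Fin.<? i) i≯j = refl
... | tri≈ i≮j i≡j i≯j rewrite dec-true (i Fin.≟ j) i≡j | dec-false (i Fin.<? j) i≮j
                             | dec-false (j Fin.<? i) i≯j = refl
... | tri> i≮j i≢j i>j rewrite dec-false (i Fin.≟ j) i≢j | dec-false (i Fin.<? j) i≮j
                             | dec-true (j Fin.<? i) i>j = refl

-- Distinct indices satisfy `i < j` or `j < i`; exchanging the two sums and using the symmetry of
-- `f` makes the second half equal to the first.
∑²-≢ : (f : Fin n → Fin n → ℕ) → (∀ i j → f i j ≡ f j i) →
       ∑² (λ i j → (i ≢ᵇ j) ℕ.* f i j) ≡ 2 ℕ.* ∑² (λ i j → (i <ᵇ j) ℕ.* f i j)
∑²-≢ f f-sym = begin
  ∑² (λ i j → (i ≢ᵇ j) ℕ.* f i j)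
    ≡⟨ ∑²-cong (λ i j → trans (cong (ℕ._* f i j) (≢ᵇ-split i j))
                              (ℕ.*-distribʳ-+ (f i j) (i <ᵇ j) (j <ᵇ i))) ⟩
  ∑² (λ i j → (i <ᵇ j) ℕ.* f i j ℕ.+ (j <ᵇ i) ℕ.* f i j)
    ≡⟨ ∑²-distrib-+ (λ i j → (i <ᵇ j) ℕ.* f i j) (λ i j → (j <ᵇ i) ℕ.* f i j) ⟩
  S ℕ.+ ∑² (λ i j → (j <ᵇ i) ℕ.* f i j)
    ≡⟨ cong (S ℕ.+_) (∑-comm (λ i j → (j <ᵇ i) ℕ.* f i j)) ⟩
  S ℕ.+ ∑² (λ j i → (j <ᵇ i) ℕ.* f i j)
    ≡⟨ cong (S ℕ.+_) (∑²-cong (λ j i → cong ((j <ᵇ i) ℕ.*_) (f-sym i j))) ⟩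
  S ℕ.+ S
    ≡⟨ cong (S ℕ.+_) (sym (ℕ.+-identityʳ S)) ⟩
  2 ℕ.* S ∎
  where S = ∑² (λ i j → (i <ᵇ j) ℕ.* f i j)

-- The missing term is added back on the left instead of being subtracted on the right. This avoids
-- truncated subtraction and leaves an induction on `i`.
∑-≢ : (f : Fin n → ℕ) (i : Fin n) →
      (∑[ j < n ] (f j ℕ.* (i ≢ᵇ j))) ℕ.+ f i ≡ ∑[ j < n ] f j
∑-≢ {suc n} f zero = begin
  f zero ℕ.* 0 ℕ.+ (∑[ j < n ] (f (suc j) ℕ.* 1)) ℕ.+ f zero
    ≡⟨ cong₂ (λ a b → a ℕ.+ b ℕ.+ f zero) (ℕ.*-zeroʳ (f zero))
             (sum-cong-≗ {n} (λ j → ℕ.*-identityʳ (f (suc j)))) ⟩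
  (∑[ j < n ] f (suc j)) ℕ.+ f zero
    ≡⟨ ℕ.+-comm _ (f zero) ⟩
  f zero ℕ.+ (∑[ j < n ] f (suc j)) ∎
∑-≢ {suc n} f (suc i) = begin
  f zero ℕ.* 1 ℕ.+ (∑[ j < n ] (f (suc j) ℕ.* (i ≢ᵇ j))) ℕ.+ f (suc i)
    ≡⟨ ℕ.+-assoc (f zero ℕ.* 1) _ (f (suc i)) ⟩
  f zero ℕ.* 1 ℕ.+ ((∑[ j < n ] (f (suc j) ℕ.* (i ≢ᵇ j))) ℕ.+ f (suc i))
    ≡⟨ cong₂ ℕ._+_ (ℕ.*-identityʳ (f zero)) (∑-≢ (f ∘ suc) i) ⟩
  f zero ℕ.+ (∑[ j < n ] f (suc j)) ∎

-- Ordered pairs of distinct elements of a subset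

χ : Subset n → Fin n → ℕ
χ S i = 𝟙 (does (i ∈? S))

∣S∣≡∑χ : (S : Subset n) → ∣ S ∣ ≡ ∑[ i < n ] χ S i
∣S∣≡∑χ Vec.[]              = refl
∣S∣≡∑χ (inside  Vec.∷ S) = cong suc (∣S∣≡∑χ S)
∣S∣≡∑χ (outside Vec.∷ S) = ∣S∣≡∑χ S

χ-tabulate : (f : Fin n → Bool) (i : Fin n) → χ (Vec.tabulate f) i ≡ 𝟙 (f i)
χ-tabulate f zero with f zero
... | true  = refl
... | false = refl
χ-tabulate f (suc i) = χ-tabulate (f ∘ suc) i

χ-∩ : (S T : Subset n) (i : Fin n) → χ (S ∩ T) i ≡ χ S i ℕ.* χ T i
χ-∩ S T i = trans
  (cong 𝟙 (does-⇔ (mk⇔ (x∈p∩q⁻ S T) x∈p∩q⁺) (i ∈? S ∩ T) (i ∈? S ×-dec i ∈? T)))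
  (𝟙-∧ (does (i ∈? S)) (does (i ∈? T)))

𝟙-distinctIn : (S : Subset n) (i j : Fin n) →
               𝟙 (does (distinctIn? S (i , j))) ≡ χ S i ℕ.* (χ S j ℕ.* (i ≢ᵇ j))
𝟙-distinctIn S i j = trans (𝟙-∧ (does (i ∈? S)) _)
                           (cong (χ S i ℕ.*_) (𝟙-∧ (does (j ∈? S)) _))

sum-distinctPairs : (S : Subset n) (f : Fin n → Fin n → ℕ) →
  sum (map (uncurry f) (distinctPairs S)) ≡
  ∑² (λ i j → χ S i ℕ.* (χ S j ℕ.* (i ≢ᵇ j)) ℕ.* f i j)
sum-distinctPairs {n} S f = begin
  sum (map (uncurry f) (distinctPairs S))
    ≡⟨ sum-filter (distinctIn? S) (uncurry f) (vertexPairs n) ⟩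
  sum (map (λ ij → 𝟙 (does (distinctIn? S ij)) ℕ.* uncurry f ij) (vertexPairs n))
    ≡⟨ sum-vertexPairs (λ ij → 𝟙 (does (distinctIn? S ij)) ℕ.* uncurry f ij) ⟩
  ∑² (λ i j → 𝟙 (does (distinctIn? S (i , j))) ℕ.* f i j)
    ≡⟨ ∑²-cong (λ i j → cong (ℕ._* f i j) (𝟙-distinctIn S i j)) ⟩
  ∑² (λ i j → χ S i ℕ.* (χ S j ℕ.* (i ≢ᵇ j)) ℕ.* f i j) ∎

length-distinctPairs-∑² : (S : Subset n) →
  length (distinctPairs S) ≡ ∑² (λ i j → χ S i ℕ.* (χ S j ℕ.* (i ≢ᵇ j)))
length-distinctPairs-∑² {n} S = begin
  length (distinctPairs S)
    ≡⟨ length-filter (distinctIn? S) (vertexPairs n) ⟩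
  sum (map (λ ij → 𝟙 (does (distinctIn? S ij))) (vertexPairs n))
    ≡⟨ sum-vertexPairs (λ ij → 𝟙 (does (distinctIn? S ij))) ⟩
  ∑² (λ i j → 𝟙 (does (distinctIn? S (i , j))))
    ≡⟨ ∑²-cong (𝟙-distinctIn S) ⟩
  ∑² (λ i j → χ S i ℕ.* (χ S j ℕ.* (i ≢ᵇ j))) ∎

-- With `b` deciding `i ∈ S`, `m` is the number of elements of `S` other than `i`. This is one less
-- than the size of `S` only for `i` in `S`; for other `i` the factor 0 hides the difference.
𝟙*m≡𝟙*[k∸1] : ∀ b {m k} → m ℕ.+ 𝟙 b ≡ k → 𝟙 b ℕ.* m ≡ 𝟙 b ℕ.* (k ∸ 1)
𝟙*m≡𝟙*[k∸1] true  {m} refl = cong (1 ℕ.*_) (sym (ℕ.m+n∸n≡m m 1))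
𝟙*m≡𝟙*[k∸1] false _        = refl

-- Each element of `S` has `∣ S ∣ ∸ 1` partners. For empty `S` the first factor is 0, so the
-- truncation is harmless.
length-distinctPairs : (S : Subset n) → length (distinctPairs S) ≡ ∣ S ∣ ℕ.* (∣ S ∣ ∸ 1)
length-distinctPairs {n} S = begin
  length (distinctPairs S)
    ≡⟨ length-distinctPairs-∑² S ⟩
  ∑² (λ i j → χ S i ℕ.* (χ S j ℕ.* (i ≢ᵇ j)))
    ≡⟨ sum-cong-≗ {n} (λ i → sym (*-distribˡ-sum {n} (χ S i) _)) ⟩
  (∑[ i < n ] (χ S i ℕ.* (∑[ j < n ] (χ S j ℕ.* (i ≢ᵇ j)))))
    ≡⟨ sum-cong-≗ {n} (λ i → 𝟙*m≡𝟙*[k∸1] (does (i ∈? S))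
                               (trans (∑-≢ (χ S) i) (sym (∣S∣≡∑χ S)))) ⟩
  (∑[ i < n ] (χ S i ℕ.* (∣ S ∣ ∸ 1)))
    ≡⟨ sym (*-distribʳ-sum {n} (∣ S ∣ ∸ 1) (χ S)) ⟩
  (∑[ i < n ] χ S i) ℕ.* (∣ S ∣ ∸ 1)
    ≡⟨ cong (ℕ._* (∣ S ∣ ∸ 1)) (sym (∣S∣≡∑χ S)) ⟩
  ∣ S ∣ ℕ.* (∣ S ∣ ∸ 1) ∎

-- Induction by Pascal's rule, C(n+1,2) = C(n,1) + C(n,2), matched with (n+1)n = 2n + n(n-1).
n*[n∸1]≡2*nC2 : ∀ n → n ℕ.* (n ∸ 1) ≡ 2 ℕ.* (n C 2)
n*[n∸1]≡2*nC2 zero          = refl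
n*[n∸1]≡2*nC2 (suc zero)    = refl
n*[n∸1]≡2*nC2 (suc n@(suc m)) = begin
  suc n ℕ.* n
    ≡⟨ rearrange m ⟩
  2 ℕ.* n ℕ.+ n ℕ.* m
    ≡⟨ cong₂ (λ a b → 2 ℕ.* a ℕ.+ b) (sym (nC1≡n n)) (n*[n∸1]≡2*nC2 n) ⟩
  2 ℕ.* (n C 1) ℕ.+ 2 ℕ.* (n C 2)
    ≡⟨ sym (ℕ.*-distribˡ-+ 2 (n C 1) (n C 2)) ⟩
  2 ℕ.* (n C 1 ℕ.+ n C 2)
    ≡⟨ cong (2 ℕ.*_) (nCk+nC[k+1]≡[n+1]C[k+1] n 1) ⟩
  2 ℕ.* (suc n C 2) ∎
  where
  rearrange : ∀ m → suc (suc m) ℕ.* suc m ≡ 2 ℕ.* suc m ℕ.+ suc m ℕ.* m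
  rearrange = ℕSolver.solve-∀

∈⇒∣S∣>0 : {S : Subset n} {i : Fin n} → i ∈ S → ∣ S ∣ > 0
∈⇒∣S∣>0 {S = S} {i} i∈S = subst (ℕ._≤ ∣ S ∣) (∣⁅x⁆∣≡1 i)
  (p⊆q⇒∣p∣≤∣q∣ (λ j∈⁅i⁆ → subst (_∈ S) (sym (x∈⁅y⁆⇒x≡y i j∈⁅i⁆)) i∈S))

-- Counting butterflies

-- Written through `Bool.≟` so that these are literally the factors arising from the side tests of
-- `isButterfly?`.
𝕃 ℝ : Bool → ℕ
𝕃 b = 𝟙 (does (b Bool.≟ true))
ℝ b = 𝟙 (does (b Bool.≟ false))

-- Here a, b, c, d are the sides of v, w, x, y. The inequalities hold along the path w, x, v, y, so
-- sides alternate on it: a = b and c = d are opposite, and exactly one of the two summands is 1.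
sides-split : ∀ a b c d → a ≢ c → a ≢ d → b ≢ c →
              𝕃 a ℕ.* 𝕃 b ℕ.* (ℝ c ℕ.* ℝ d) ℕ.+ 𝕃 c ℕ.* 𝕃 d ℕ.* (ℝ a ℕ.* ℝ b) ≡ 1
sides-split true  true  false false _   _   _   = refl
sides-split false false true  true  _   _   _   = refl
sides-split true  _     true  _     a≢c _   _   = contradiction refl a≢c
sides-split false _     false _     a≢c _   _   = contradiction refl a≢c
sides-split true  _     false true  _   a≢d _   = contradiction refl a≢d
sides-split false _     true  false _   a≢d _   = contradiction refl a≢d
sides-split true  false false false _   _   b≢c = contradiction refl b≢c
sides-split false true  true  true  _   _   b≢c = contradiction refl b≢c

module _ (G : BipartiteGraph n) where
  open BipartiteGraph G

  edge : Fin n → Fin n → ℕ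
  edge v w = 𝟙 (does (adj? v w))

  edge-sym : ∀ v w → edge v w ≡ edge w v
  edge-sym v w = cong 𝟙 (does-⇔ (mk⇔ adj-sym adj-sym) (adj? v w) (adj? w v))

  χ-Γ : ∀ v w → χ (Γ G v) w ≡ edge v w
  χ-Γ v = χ-tabulate (λ w → does (adj? v w))

  χ-Γ∩Γ : ∀ v w x → χ (Γ G v ∩ Γ G w) x ≡ edge v x ℕ.* edge w x
  χ-Γ∩Γ v w x = trans (χ-∩ (Γ G v) (Γ G w) x) (cong₂ ℕ._*_ (χ-Γ v x) (χ-Γ w x))

  -- By `χ-Γ`, membership and adjacency have the same indicator; if only one of them held, this
  -- equation would read 1 = 0.
  ∈Γ⇒Adj : ∀ {v w} → w ∈ Γ G v → Adj v w
  ∈Γ⇒Adj {v} {w} w∈Γv with adj? v w | χ-Γ v w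
  ... | yes vw | _ = vw
  ... | no  _  | χ≡0 rewrite dec-true (w ∈? Γ G v) w∈Γv = contradiction χ≡0 λ ()

  Adj⇒∈Γ : ∀ {v w} → Adj v w → w ∈ Γ G v
  Adj⇒∈Γ {v} {w} vw with w ∈? Γ G v | χ-Γ v w
  ... | yes w∈Γv | _ = w∈Γv
  ... | no  _    | 0≡edge rewrite dec-true (adj? v w) vw = contradiction 0≡edge λ ()

  codeg : Fin n → Fin n → ℕ
  codeg v w = ∣ Γ G v ∩ Γ G w ∣

  -- The vertex `u` itself is a common neighbour of `v` and `w`. Hence β is never negative for a
  -- sampled pair.
  codeg>0 : ∀ {u v w} → v ∈ Γ G u → w ∈ Γ G u → codeg v w > 0
  codeg>0 v∈Γu w∈Γu = ∈⇒∣S∣>0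
    (x∈p∩q⁺ (Adj⇒∈Γ (adj-sym (∈Γ⇒Adj v∈Γu)) , Adj⇒∈Γ (adj-sym (∈Γ⇒Adj w∈Γu))))

  -- Only the four edges are tested. Distinctness within each pair, and which pair lies on the left,
  -- are imposed by separate factors.
  biclique : Fin n → Fin n → Fin n → Fin n → ℕ
  biclique v w x y = edge v x ℕ.* (edge v y ℕ.* (edge w x ℕ.* edge w y))

  biclique-swapˡ : ∀ v w x y → biclique v w x y ≡ biclique w v x y
  biclique-swapˡ v w x y = rearrange (edge v x) (edge v y) (edge w x) (edge w y)
    where
    rearrange : ∀ a b c d → a ℕ.* (b ℕ.* (c ℕ.* d)) ≡ c ℕ.* (d ℕ.* (a ℕ.* b))
    rearrange = ℕSolver.solve-∀

  biclique-swapʳ : ∀ v w x y → biclique v w x y ≡ biclique v w y x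
  biclique-swapʳ v w x y = rearrange (edge v x) (edge v y) (edge w x) (edge w y)
    where
    rearrange : ∀ a b c d → a ℕ.* (b ℕ.* (c ℕ.* d)) ≡ b ℕ.* (a ℕ.* (d ℕ.* c))
    rearrange = ℕSolver.solve-∀

  biclique-flip : ∀ v w x y → biclique v w x y ≡ biclique x y v w
  biclique-flip v w x y
    rewrite edge-sym v x | edge-sym v y | edge-sym w x | edge-sym w y =
    rearrange (edge x v) (edge y v) (edge x w) (edge y w)
    where
    rearrange : ∀ a b c d → a ℕ.* (b ℕ.* (c ℕ.* d)) ≡ a ℕ.* (c ℕ.* (b ℕ.* d))
    rearrange = ℕSolver.solve-∀

  leftRight : Fin n → Fin n → Fin n → Fin n → ℕ
  leftRight v w x y = 𝕃 (side v) ℕ.* 𝕃 (side w) ℕ.* (ℝ (side x) ℕ.* ℝ (side y))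

  -- Splits a biclique by which of its two pairs is on the left. If an edge is missing, both sides
  -- vanish; otherwise `sides-split` says that exactly one orientation occurs.
  biclique-sides : ∀ v w x y → biclique v w x y ≡
                   leftRight v w x y ℕ.* biclique v w x y ℕ.+
                   leftRight x y v w ℕ.* biclique v w x y
  biclique-sides v w x y = trans (aux (adj? v x) (adj? v y) (adj? w x))
    (ℕ.*-distribʳ-+ (biclique v w x y) (leftRight v w x y) (leftRight x y v w))
    where
    s = leftRight v w x y ℕ.+ leftRight x y v w

    -- The decisions are passed as arguments so that they can be matched on; at the actual decisions
    -- `k` is `biclique v w x y`.
    aux : (vx : Dec (Adj v x)) (vy : Dec (Adj v y)) (wx : Dec (Adj w x)) →
          let k = 𝟙 (does vx) ℕ.* (𝟙 (does vy) ℕ.* (𝟙 (does wx) ℕ.* edge w y)) in k ≡ s ℕ.* k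
    aux (no  _)  _        _        = sym (ℕ.*-zeroʳ s)
    aux (yes _)  (no  _)  _        = sym (ℕ.*-zeroʳ s)
    aux (yes _)  (yes _)  (no  _)  = sym (ℕ.*-zeroʳ s)
    aux (yes vx) (yes vy) (yes wx)
      rewrite sides-split (side v) (side w) (side x) (side y) (proper vx) (proper vy) (proper wx)
      = sym (ℕ.*-identityˡ _)

  orderedBicliquesOn : Fin n → Fin n → ℕ
  orderedBicliquesOn v w = ∑² λ x y → (x <ᵇ y) ℕ.* biclique v w x y

  -- Each pair is listed in increasing order only, but either pair may come first, since no side is
  -- prescribed.
  orderedBicliques : ℕ
  orderedBicliques = ∑² λ v w → (v <ᵇ w) ℕ.* orderedBicliquesOn v w

  𝟙-isButterfly : ∀ v w x y → 𝟙 (does (isButterfly? G ((v , w) , (x , y)))) ≡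
                  (v <ᵇ w) ℕ.* ((x <ᵇ y) ℕ.* (leftRight v w x y ℕ.* biclique v w x y))
  𝟙-isButterfly v w x y
    -- `does` turns `_×-dec_` into conjunction, so the indicator is peeled into factors from the
    -- outside in.
    rewrite 𝟙-∧₃ (does (v Fin.<? w)) (does (side v Bool.≟ true)) (does (side w Bool.≟ true))
              (does ((x Fin.<? y ×-dec side x Bool.≟ false ×-dec side y Bool.≟ false) ×-dec
                     (adj? v x ×-dec adj? v y ×-dec adj? w x ×-dec adj? w y)))
          | 𝟙-∧₃ (does (x Fin.<? y)) (does (side x Bool.≟ false)) (does (side y Bool.≟ false))
              (does (adj? v x ×-dec adj? v y ×-dec adj? w x ×-dec adj? w y))
          | 𝟙-∧ (does (adj? v x)) (does (adj? v y ×-dec adj? w x ×-dec adj? w y))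
          | 𝟙-∧ (does (adj? v y)) (does (adj? w x ×-dec adj? w y))
          | 𝟙-∧ (does (adj? w x)) (does (adj? w y))
    = rearrange (v <ᵇ w) (𝕃 (side v)) (𝕃 (side w)) (x <ᵇ y) (ℝ (side x)) (ℝ (side y))
                (biclique v w x y)
    where
    rearrange : ∀ a b c d e f k → a ℕ.* b ℕ.* c ℕ.* (d ℕ.* e ℕ.* f ℕ.* k) ≡
                                  a ℕ.* (d ℕ.* (b ℕ.* c ℕ.* (e ℕ.* f) ℕ.* k))
    rearrange = ℕSolver.solve-∀

  #butterflies-∑² : #butterflies G ≡ ∑² λ v w → ∑² λ x y →
                    (v <ᵇ w) ℕ.* ((x <ᵇ y) ℕ.* (leftRight v w x y ℕ.* biclique v w x y))
  #butterflies-∑² = begin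
    #butterflies G
      ≡⟨ length-filter (isButterfly? G) (cartesianProduct (vertexPairs n) (vertexPairs n)) ⟩
    sum (map isB (cartesianProduct (vertexPairs n) (vertexPairs n)))
      ≡⟨ sum-cartesianProduct isB (vertexPairs n) (vertexPairs n) ⟩
    sum (map (λ p → sum (map (λ q → isB (p , q)) (vertexPairs n))) (vertexPairs n))
      ≡⟨ sum-vertexPairs (λ p → sum (map (λ q → isB (p , q)) (vertexPairs n))) ⟩
    ∑² (λ v w → sum (map (λ q → isB ((v , w) , q)) (vertexPairs n)))
      ≡⟨ ∑²-cong (λ v w → sum-vertexPairs (λ q → isB ((v , w) , q))) ⟩
    ∑² (λ v w → ∑² λ x y → isB ((v , w) , (x , y)))
      ≡⟨ ∑²-cong (λ v w → ∑²-cong (𝟙-isButterfly v w)) ⟩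
    ∑² (λ v w → ∑² λ x y →
      (v <ᵇ w) ℕ.* ((x <ᵇ y) ℕ.* (leftRight v w x y ℕ.* biclique v w x y))) ∎
    where
    isB : (Fin n × Fin n) × (Fin n × Fin n) → ℕ
    isB q = 𝟙 (does (isButterfly? G q))

  -- After the split by orientation, the half with (v , w) on the left counts butterflies directly;
  -- the other half is the same sum with the two pairs exchanged, and `∑²-comm` identifies them.
  orderedBicliques≡2*#butterflies : orderedBicliques ≡ 2 ℕ.* #butterflies G
  orderedBicliques≡2*#butterflies = begin
    orderedBicliques
      ≡⟨ ∑²-cong (λ v w → *-distribˡ-∑² (v <ᵇ w) λ x y → (x <ᵇ y) ℕ.* biclique v w x y) ⟩
    ∑² (λ v w → ∑² λ x y → (v <ᵇ w) ℕ.* ((x <ᵇ y) ℕ.* biclique v w x y))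
      ≡⟨ ∑²-cong (λ v w → ∑²-cong (split v w)) ⟩
    ∑² (λ v w → ∑² λ x y → b v w x y ℕ.+ b x y v w)
      ≡⟨ ∑²-cong (λ v w → ∑²-distrib-+ (b v w) (λ x y → b x y v w)) ⟩
    ∑² (λ v w → ∑² (b v w) ℕ.+ ∑² (λ x y → b x y v w))
      ≡⟨ ∑²-distrib-+ (λ v w → ∑² (b v w)) (λ v w → ∑² (λ x y → b x y v w)) ⟩
    ∑² (λ v w → ∑² (b v w)) ℕ.+ ∑² (λ v w → ∑² (λ x y → b x y v w))
      ≡⟨ cong₂ ℕ._+_ (sym #butterflies-∑²)
               (trans (∑²-comm (λ v w x y → b x y v w)) (sym #butterflies-∑²)) ⟩
    #butterflies G ℕ.+ #butterflies G
      ≡⟨ cong (#butterflies G ℕ.+_) (sym (ℕ.+-identityʳ (#butterflies G))) ⟩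
    2 ℕ.* #butterflies G ∎
    where
    b : Fin n → Fin n → Fin n → Fin n → ℕ
    b v w x y = (v <ᵇ w) ℕ.* ((x <ᵇ y) ℕ.* (leftRight v w x y ℕ.* biclique v w x y))

    rearrange : ∀ p q k s t → p ℕ.* (q ℕ.* (s ℕ.* k ℕ.+ t ℕ.* k)) ≡
                              p ℕ.* (q ℕ.* (s ℕ.* k)) ℕ.+ q ℕ.* (p ℕ.* (t ℕ.* k))
    rearrange = ℕSolver.solve-∀

    split : ∀ v w x y → (v <ᵇ w) ℕ.* ((x <ᵇ y) ℕ.* biclique v w x y) ≡ b v w x y ℕ.+ b x y v w
    split v w x y = begin
      (v <ᵇ w) ℕ.* ((x <ᵇ y) ℕ.* biclique v w x y)
        ≡⟨ cong (λ k → (v <ᵇ w) ℕ.* ((x <ᵇ y) ℕ.* k)) (biclique-sides v w x y) ⟩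
      (v <ᵇ w) ℕ.* ((x <ᵇ y) ℕ.* (leftRight v w x y ℕ.* biclique v w x y ℕ.+
                                  leftRight x y v w ℕ.* biclique v w x y))
        ≡⟨ rearrange (v <ᵇ w) (x <ᵇ y) (biclique v w x y) (leftRight v w x y) (leftRight x y v w) ⟩
      b v w x y ℕ.+ (x <ᵇ y) ℕ.* ((v <ᵇ w) ℕ.* (leftRight x y v w ℕ.* biclique v w x y))
        -- Only the second summand is flipped, which makes it `b` with its pairs exchanged.
        ≡⟨ cong (λ k → b v w x y ℕ.+ (x <ᵇ y) ℕ.* ((v <ᵇ w) ℕ.* (leftRight x y v w ℕ.* k)))
                (biclique-flip v w x y) ⟩
      b v w x y ℕ.+ b x y v w ∎

  -- Both sides count ordered pairs of distinct common neighbours of `v` and `w`; any such pair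
  -- completes `v` and `w` to a biclique.
  codeg*[codeg∸1] : ∀ v w → codeg v w ℕ.* (codeg v w ∸ 1) ≡
                    ∑² (λ x y → (x ≢ᵇ y) ℕ.* biclique v w x y)
  codeg*[codeg∸1] v w = begin
    codeg v w ℕ.* (codeg v w ∸ 1)
      ≡⟨ sym (length-distinctPairs S) ⟩
    length (distinctPairs S)
      ≡⟨ length-distinctPairs-∑² S ⟩
    ∑² (λ x y → χ S x ℕ.* (χ S y ℕ.* (x ≢ᵇ y)))
      ≡⟨ ∑²-cong (λ x y → trans
           (cong₂ (λ a b → a ℕ.* (b ℕ.* (x ≢ᵇ y))) (χ-Γ∩Γ v w x) (χ-Γ∩Γ v w y))
           (rearrange (edge v x) (edge v y) (edge w x) (edge w y) (x ≢ᵇ y))) ⟩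
    ∑² (λ x y → (x ≢ᵇ y) ℕ.* biclique v w x y) ∎
    where
    S = Γ G v ∩ Γ G w

    rearrange : ∀ a b c d k → a ℕ.* c ℕ.* (b ℕ.* d ℕ.* k) ≡ k ℕ.* (a ℕ.* (b ℕ.* (c ℕ.* d)))
    rearrange = ℕSolver.solve-∀

  -- By `codeg>0` the truncated subtraction agrees on these pairs with the integer subtraction in
  -- `WSamp`.
  β-sum : Fin n → ℕ
  β-sum u = sum (map (λ (v , w) → codeg v w ∸ 1) (distinctPairs (Γ G u)))

  -- For fixed `v` and `w` the value β does not depend on the centre `u`, and the possible centres
  -- are the `codeg v w` common neighbours.
  ∑β-sum : ∑[ u < n ] β-sum u ≡ ∑² (λ v w → (v ≢ᵇ w) ℕ.* (codeg v w ℕ.* (codeg v w ∸ 1)))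
  ∑β-sum = begin
    ∑[ u < n ] β-sum u
      ≡⟨ sum-cong-≗ {n} (λ u → sum-distinctPairs (Γ G u) (λ v w → codeg v w ∸ 1)) ⟩
    ∑[ u < n ] ∑² (λ v w → χ (Γ G u) v ℕ.* (χ (Γ G u) w ℕ.* (v ≢ᵇ w)) ℕ.* (codeg v w ∸ 1))
      ≡⟨ ∑²-∑-comm (λ u v w → χ (Γ G u) v ℕ.* (χ (Γ G u) w ℕ.* (v ≢ᵇ w)) ℕ.* (codeg v w ∸ 1)) ⟩
    ∑² (λ v w → ∑[ u < n ] (χ (Γ G u) v ℕ.* (χ (Γ G u) w ℕ.* (v ≢ᵇ w)) ℕ.* (codeg v w ∸ 1)))
      ≡⟨ ∑²-cong collect ⟩
    ∑² (λ v w → (v ≢ᵇ w) ℕ.* (codeg v w ℕ.* (codeg v w ∸ 1))) ∎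
    where
    rearrange : ∀ a b k c → a ℕ.* (b ℕ.* k) ℕ.* c ≡ (k ℕ.* c) ℕ.* (a ℕ.* b)
    rearrange = ℕSolver.solve-∀

    rearrange′ : ∀ k a b → (k ℕ.* a) ℕ.* b ≡ k ℕ.* (b ℕ.* a)
    rearrange′ = ℕSolver.solve-∀

    collect : ∀ v w →
      (∑[ u < n ] (χ (Γ G u) v ℕ.* (χ (Γ G u) w ℕ.* (v ≢ᵇ w)) ℕ.* (codeg v w ∸ 1))) ≡
      (v ≢ᵇ w) ℕ.* (codeg v w ℕ.* (codeg v w ∸ 1))
    collect v w = begin
      (∑[ u < n ] (χ (Γ G u) v ℕ.* (χ (Γ G u) w ℕ.* (v ≢ᵇ w)) ℕ.* (codeg v w ∸ 1)))
        ≡⟨ sum-cong-≗ {n} (λ u → trans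
             (rearrange (χ (Γ G u) v) (χ (Γ G u) w) (v ≢ᵇ w) (codeg v w ∸ 1))
             (cong (((v ≢ᵇ w) ℕ.* (codeg v w ∸ 1)) ℕ.*_) (begin
               χ (Γ G u) v ℕ.* χ (Γ G u) w ≡⟨ cong₂ ℕ._*_ (χ-Γ u v) (χ-Γ u w) ⟩
               edge u v ℕ.* edge u w       ≡⟨ cong₂ ℕ._*_ (edge-sym u v) (edge-sym u w) ⟩
               edge v u ℕ.* edge w u       ≡⟨ sym (χ-Γ∩Γ v w u) ⟩
               χ (Γ G v ∩ Γ G w) u         ∎))) ⟩
      (∑[ u < n ] ((v ≢ᵇ w) ℕ.* (codeg v w ∸ 1) ℕ.* χ (Γ G v ∩ Γ G w) u))
        ≡⟨ sym (*-distribˡ-sum {n} ((v ≢ᵇ w) ℕ.* (codeg v w ∸ 1)) (χ (Γ G v ∩ Γ G w))) ⟩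
      (v ≢ᵇ w) ℕ.* (codeg v w ∸ 1) ℕ.* (∑[ u < n ] χ (Γ G v ∩ Γ G w) u)
        ≡⟨ cong ((v ≢ᵇ w) ℕ.* (codeg v w ∸ 1) ℕ.*_) (sym (∣S∣≡∑χ (Γ G v ∩ Γ G w))) ⟩
      (v ≢ᵇ w) ℕ.* (codeg v w ∸ 1) ℕ.* codeg v w
        ≡⟨ rearrange′ (v ≢ᵇ w) (codeg v w ∸ 1) (codeg v w) ⟩
      (v ≢ᵇ w) ℕ.* (codeg v w ℕ.* (codeg v w ∸ 1)) ∎

  -- The three factors of 2 appear in this order: the order of x and y, the order of v and w, and
  -- the choice of the left pair.
  ∑β-sum≡8*#butterflies : sum (map β-sum (allFin n)) ≡ 8 ℕ.* #butterflies G
  ∑β-sum≡8*#butterflies = begin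
    sum (map β-sum (allFin n))
      ≡⟨ sum-map-tabulate β-sum (λ u → u) ⟩
    ∑[ u < n ] β-sum u
      ≡⟨ ∑β-sum ⟩
    ∑² (λ v w → (v ≢ᵇ w) ℕ.* (codeg v w ℕ.* (codeg v w ∸ 1)))
      ≡⟨ ∑²-cong (λ v w → cong ((v ≢ᵇ w) ℕ.*_) (trans (codeg*[codeg∸1] v w)
           (∑²-≢ (biclique v w) (biclique-swapʳ v w)))) ⟩
    ∑² (λ v w → (v ≢ᵇ w) ℕ.* (2 ℕ.* orderedBicliquesOn v w))
      ≡⟨ ∑²-≢ (λ v w → 2 ℕ.* orderedBicliquesOn v w) (λ v w → cong (2 ℕ.*_)
           (∑²-cong (λ x y → cong ((x <ᵇ y) ℕ.*_) (biclique-swapˡ v w x y)))) ⟩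
    2 ℕ.* ∑² (λ v w → (v <ᵇ w) ℕ.* (2 ℕ.* orderedBicliquesOn v w))
      ≡⟨ cong (2 ℕ.*_) (∑²-cong (λ v w → rearrange (v <ᵇ w) (orderedBicliquesOn v w))) ⟩
    2 ℕ.* ∑² (λ v w → 2 ℕ.* ((v <ᵇ w) ℕ.* orderedBicliquesOn v w))
      ≡⟨ cong (2 ℕ.*_) (sym (*-distribˡ-∑² 2 (λ v w → (v <ᵇ w) ℕ.* orderedBicliquesOn v w))) ⟩
    2 ℕ.* (2 ℕ.* orderedBicliques)
      ≡⟨ cong (λ k → 2 ℕ.* (2 ℕ.* k)) orderedBicliques≡2*#butterflies ⟩
    2 ℕ.* (2 ℕ.* (2 ℕ.* #butterflies G))
      ≡⟨ rearrange′ (#butterflies G) ⟩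
    8 ℕ.* #butterflies G ∎
    where
    rearrange : ∀ a b → a ℕ.* (2 ℕ.* b) ≡ 2 ℕ.* (a ℕ.* b)
    rearrange = ℕSolver.solve-∀

    rearrange′ : ∀ a → 2 ℕ.* (2 ℕ.* (2 ℕ.* a)) ≡ 8 ℕ.* a
    rearrange′ = ℕSolver.solve-∀

  length-distinctPairs-Γ : ∀ u → length (distinctPairs (Γ G u)) ≡ 2 ℕ.* wedgesAt G u
  length-distinctPairs-Γ u = trans (length-distinctPairs (Γ G u)) (n*[n∸1]≡2*nC2 (deg G u))

  -- Vertices of weight 0 are left out by `weighted`; since they have no pairs of distinct
  -- neighbours, a sum over all vertices may include them.
  wedgesAt≡0⇒β-sum≡0 : ∀ u → wedgesAt G u ≡ 0 → β-sum u ≡ 0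
  wedgesAt≡0⇒β-sum≡0 u w≡0
    with distinctPairs (Γ G u) | trans (length-distinctPairs-Γ u) (cong (2 ℕ.*_) w≡0)
  ... | [] | _ = refl

-- Fractions and expectations

-- `_/_` reduces to lowest terms, so equality is imported from unnormalised rationals, where it is
-- cross-multiplication. Matching on `suc` exposes both fractions as images of `fromℚᵘ`.
/-≃ : ∀ p q m n .{{_ : NonZero m}} .{{_ : NonZero n}} → p ℤ.* + n ≡ q ℤ.* + m → p / m ≡ q / n
/-≃ p q m@(suc m-1) n@(suc n-1) eq =
  ℚ.fromℚᵘ-cong {ℚᵘ.mkℚᵘ p m-1} {ℚᵘ.mkℚᵘ q n-1} (ℚᵘ.*≡* eq)

/-+ : ∀ a b N .{{_ : NonZero N}} → (+ a / N) + (+ b / N) ≡ + (a ℕ.+ b) / N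
/-+ a b N@(suc N-1) = ℚ.toℚᵘ-injective (begin≃
  toℚᵘ ((+ a / N) + (+ b / N))
    ≈⟨ ℚ.toℚᵘ-homo-+ (+ a / N) (+ b / N) ⟩
  toℚᵘ (+ a / N) ℚᵘ.+ toℚᵘ (+ b / N)
    ≈⟨ ℚᵘ.+-cong (ℚ.toℚᵘ-fromℚᵘ (ℚᵘ.mkℚᵘ (+ a) N-1)) (ℚ.toℚᵘ-fromℚᵘ (ℚᵘ.mkℚᵘ (+ b) N-1)) ⟩
  ℚᵘ.mkℚᵘ (+ a) N-1 ℚᵘ.+ ℚᵘ.mkℚᵘ (+ b) N-1
    ≈⟨ ℚᵘ.*≡* (trans (cong (ℤ._* + N) (sym (ℤ.*-distribʳ-+ (+ N) (+ a) (+ b))))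
                     (ℤ.*-assoc (+ a ℤ.+ + b) (+ N) (+ N))) ⟩
  ℚᵘ.mkℚᵘ (+ (a ℕ.+ b)) N-1
    ≈⟨ ℚᵘ.≃-sym (ℚ.toℚᵘ-fromℚᵘ (ℚᵘ.mkℚᵘ (+ (a ℕ.+ b)) N-1)) ⟩
  toℚᵘ (+ (a ℕ.+ b) / N) ∎≃)
  where open import Relation.Binary.Reasoning.Setoid ℚᵘ.≃-setoid
          renaming (begin_ to begin≃_; _∎ to _∎≃)

/-* : ∀ p q m n .{{_ : NonZero m}} .{{_ : NonZero n}} →
      (p / m) * (q / n) ≡ ((p ℤ.* q) / (m ℕ.* n)) {{ℕ.m*n≢0 m n}}
/-* p q m@(suc m-1) n@(suc n-1) = ℚ.toℚᵘ-injective (begin≃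
  toℚᵘ ((p / m) * (q / n))
    ≈⟨ ℚ.toℚᵘ-homo-* (p / m) (q / n) ⟩
  toℚᵘ (p / m) ℚᵘ.* toℚᵘ (q / n)
    ≈⟨ ℚᵘ.*-cong (ℚ.toℚᵘ-fromℚᵘ (ℚᵘ.mkℚᵘ p m-1)) (ℚ.toℚᵘ-fromℚᵘ (ℚᵘ.mkℚᵘ q n-1)) ⟩
  ℚᵘ.mkℚᵘ p m-1 ℚᵘ.* ℚᵘ.mkℚᵘ q n-1
    ≈⟨ ℚᵘ.≃-sym (ℚ.toℚᵘ-fromℚᵘ (ℚᵘ.mkℚᵘ p m-1 ℚᵘ.* ℚᵘ.mkℚᵘ q n-1)) ⟩
  toℚᵘ ((p ℤ.* q) / (m ℕ.* n)) ∎≃)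
  where open import Relation.Binary.Reasoning.Setoid ℚᵘ.≃-setoid
          renaming (begin_ to begin≃_; _∎ to _∎≃)

sumℚ-/ : ∀ N .{{_ : NonZero N}} (f : A → ℕ) (xs : List A) →
         sumℚ (map (λ x → + f x / N) xs) ≡ + sum (map f xs) / N
sumℚ-/ N f []       = sym (ℚ.0/n≡0 N)
sumℚ-/ N f (x ∷ xs) =
  trans (cong (λ t → (+ f x / N) + t) (sumℚ-/ N f xs)) (/-+ (f x) (sum (map f xs)) N)

-- `𝔼` on bare lists: the tails met in an induction need not have total mass 1, so they are not
-- distributions.
expect : List (ℚ × ℚ) → ℚ
expect xs = sumℚ (map (λ (y , p) → p * y) xs)

expect-++ : ∀ xs ys → expect (xs ++ ys) ≡ expect xs + expect ys
expect-++ []             ys = sym (ℚ.+-identityˡ (expect ys))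
expect-++ ((y , p) ∷ xs) ys =
  trans (cong (λ t → p * y + t) (expect-++ xs ys)) (sym (ℚ.+-assoc (p * y) (expect xs) (expect ys)))

expect-scale : ∀ p xs → expect (scale p xs) ≡ p * expect xs
expect-scale p []             = sym (ℚ.*-zeroʳ p)
expect-scale p ((y , q) ∷ xs) =
  trans (cong₂ _+_ (ℚ.*-assoc p q y) (expect-scale p xs))
        (sym (ℚ.*-distribˡ-+ p (q * y) (expect xs)))

-- The law of total expectation.
expect-bind : (xs : List (A × ℚ)) (k : A → Dist ℚ) →
              expect (bindOutcomes xs k) ≡ sumℚ (map (λ (a , p) → p * 𝔼 (k a)) xs)
expect-bind []             k = refl
expect-bind ((a , p) ∷ xs) k =
  trans (expect-++ (scale p (outcomes (k a))) (bindOutcomes xs k))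
        (cong₂ _+_ (expect-scale p (outcomes (k a))) (expect-bind xs k))

𝔼-return : ∀ y → 𝔼 (return y) ≡ y
𝔼-return y = trans (ℚ.+-identityʳ (1ℚ * y)) (ℚ.*-identityˡ y)

-- The factor `p`, the probability of the preceding choice, is carried along because only its
-- product with the uniform probability yields terms over the fixed denominator `N`. The equations
-- are required just for listed outcomes, where membership facts are at hand.
*-𝔼-uniform : ∀ N .{{_ : NonZero N}} p (as : List A) (pos : length as > 0) (k : A → Dist ℚ)
  (f : A → ℕ) →
  All (λ a → p * ((+ 1 / length as) {{>-nonZero pos}} * 𝔼 (k a)) ≡ + f a / N) as →
  p * 𝔼 (uniform as pos >>= k) ≡ + sum (map f as) / N
*-𝔼-uniform N p as pos k f eqs = begin
  p * 𝔼 (uniform as pos >>= k)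
    ≡⟨ cong (p *_) (expect-bind (outcomes (uniform as pos)) k) ⟩
  p * sumℚ (map (λ (a , q) → q * 𝔼 (k a)) (normaliseBy (length as) (map (_, 1) as)))
    ≡⟨ distrib eqs ⟩
  sumℚ (map (λ a → + f a / N) as)
    ≡⟨ sumℚ-/ N f as ⟩
  + sum (map f as) / N ∎
  where
  instance _ = >-nonZero pos

  L = length as

  -- The probability `1 / L` stays that of the full list while `bs` shrinks.
  distrib : ∀ {bs} → All (λ a → p * ((+ 1 / L) * 𝔼 (k a)) ≡ + f a / N) bs →
    p * sumℚ (map (λ (a , q) → q * 𝔼 (k a)) (normaliseBy L (map (_, 1) bs))) ≡
    sumℚ (map (λ a → + f a / N) bs)
  distrib []         = ℚ.*-zeroʳ p
  distrib (eq ∷ eqs) = trans (ℚ.*-distribˡ-+ p _ _) (cong₂ _+_ eq (distrib eqs))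

-- The last hypothesis accounts for the outcomes that `support` drops, so that the result is a sum
-- over all of `as`.
𝔼-weighted : ∀ N .{{_ : NonZero N}} (w : A → ℕ) (as : List A) (pos : sum (map w as) > 0)
  (k : (∃ λ a → w a > 0) → Dist ℚ) (f : A → ℕ) →
  (∀ a wa>0 → (+ w a / sum (map w as)) {{>-nonZero pos}} * 𝔼 (k (a , wa>0)) ≡ + f a / N) →
  (∀ a → w a ≡ 0 → f a ≡ 0) →
  𝔼 (weighted w as pos >>= k) ≡ + sum (map f as) / N
𝔼-weighted N w as pos k f eq f≡0 = begin
  𝔼 (weighted w as pos >>= k)
    ≡⟨ expect-bind (outcomes (weighted w as pos)) k ⟩
  sumℚ (map (λ (a , q) → q * 𝔼 (k a)) (normaliseBy W (support w as)))
    ≡⟨ collect as ⟩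
  + sum (map f as) / N ∎
  where
  instance _ = >-nonZero pos

  W = sum (map w as)

  collect : ∀ bs → sumℚ (map (λ (a , q) → q * 𝔼 (k a)) (normaliseBy W (support w bs))) ≡
                   + sum (map f bs) / N
  collect []       = sym (ℚ.0/n≡0 N)
  collect (b ∷ bs) with w b ℕ.>? 0
  ... | yes wb>0 = trans (cong₂ _+_ (eq b wb>0) (collect bs)) (/-+ (f b) (sum (map f bs)) N)
  -- The dropped outcome is put back as a summand 0.
  ... | no  wb≯0 = trans (collect bs)
    (cong (λ m → + (m ℕ.+ sum (map f bs)) / N) (sym (f≡0 b (ℕ.n≤0⇒n≡0 (ℕ.≮⇒≥ wb≯0)))))

-- `W` cancels, and so does `k` because `L` is `2 * k`; the constants 2 and 4 leave 8. Writing `c`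
-- as `suc b` makes the integer c - 1 compute to `+ b`.
weight-cancel : ∀ k W L c .{{_ : NonZero W}} .{{_ : NonZero L}} → L ≡ 2 ℕ.* k → c > 0 →
  (+ k / W) * ((+ 1 / L) * (((+ c ℤ.- 1ℤ) ℤ.* + W) / 4)) ≡ + (c ∸ 1) / 8
weight-cancel k W L (suc b) L≡2k _ = begin
  (+ k / W) * ((+ 1 / L) * ((+ b ℤ.* + W) / 4))
    ≡⟨ cong ((+ k / W) *_) (/-* (+ 1) (+ b ℤ.* + W) L 4) ⟩
  (+ k / W) * ((+ 1 ℤ.* (+ b ℤ.* + W)) / (L ℕ.* 4))
    ≡⟨ /-* (+ k) (+ 1 ℤ.* (+ b ℤ.* + W)) W (L ℕ.* 4) ⟩
  (+ k ℤ.* (+ 1 ℤ.* (+ b ℤ.* + W))) / (W ℕ.* (L ℕ.* 4))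
    ≡⟨ /-≃ (+ k ℤ.* (+ 1 ℤ.* (+ b ℤ.* + W))) (+ b) (W ℕ.* (L ℕ.* 4)) 8 cross ⟩
  + b / 8 ∎
  where
  instance
    L*4≢0   = ℕ.m*n≢0 L 4
    W*L*4≢0 = ℕ.m*n≢0 W (L ℕ.* 4)

  rearrange : ∀ k b W → k ℤ.* (+ 1 ℤ.* (b ℤ.* W)) ℤ.* + 8 ≡ b ℤ.* (W ℤ.* (+ 2 ℤ.* k ℤ.* + 4))
  rearrange = ℤSolver.solve-∀

  denominator : + (W ℕ.* (L ℕ.* 4)) ≡ + W ℤ.* (+ 2 ℤ.* + k ℤ.* + 4)
  denominator = begin
    + (W ℕ.* (L ℕ.* 4))              ≡⟨ ℤ.pos-* W (L ℕ.* 4) ⟩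
    + W ℤ.* + (L ℕ.* 4)              ≡⟨ cong (+ W ℤ.*_) (ℤ.pos-* L 4) ⟩
    + W ℤ.* (+ L ℤ.* + 4)            ≡⟨ cong (λ l → + W ℤ.* (+ l ℤ.* + 4)) L≡2k ⟩
    + W ℤ.* (+ (2 ℕ.* k) ℤ.* + 4)    ≡⟨ cong (λ l → + W ℤ.* (l ℤ.* + 4)) (ℤ.pos-* 2 k) ⟩
    + W ℤ.* (+ 2 ℤ.* + k ℤ.* + 4)    ∎

  cross : + k ℤ.* (+ 1 ℤ.* (+ b ℤ.* + W)) ℤ.* + 8 ≡ + b ℤ.* + (W ℕ.* (L ℕ.* 4))
  cross = trans (rearrange (+ k) (+ b) (+ W)) (cong (+ b ℤ.*_) (sym denominator))

-- The expectation of the return value of `WSamp`.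

lemma10 : ∀ {n : ℕ} (G : BipartiteGraph n) (wedges>0 : wedges G > 0) → 𝔼 (WSamp G wedges>0) ≡ + #butterflies G / 1
lemma10 {n} G wedges>0 = begin
  𝔼 (WSamp G wedges>0)
    ≡⟨ 𝔼-weighted 8 (wedgesAt G) (allFin n) wedges>0 pickPair (β-sum G) 𝔼-pickPair
                  (wedgesAt≡0⇒β-sum≡0 G) ⟩
  + sum (map (β-sum G) (allFin n)) / 8
    ≡⟨ cong (λ m → + m / 8) (∑β-sum≡8*#butterflies G) ⟩
  + (8 ℕ.* b) / 8
    ≡⟨ /-≃ (+ (8 ℕ.* b)) (+ b) 8 1 (begin
         + (8 ℕ.* b) ℤ.* + 1 ≡⟨ ℤ.*-identityʳ (+ (8 ℕ.* b)) ⟩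
         + (8 ℕ.* b)         ≡⟨ cong +_ (ℕ.*-comm 8 b) ⟩
         + (b ℕ.* 8)         ≡⟨ ℤ.pos-* b 8 ⟩
         + b ℤ.* + 8         ∎) ⟩
  + b / 1 ∎
  where
  instance _ = >-nonZero wedges>0

  b = #butterflies G

  -- `Y` and `pickPair` name the continuations inside `WSamp`, so that the general lemmas apply by
  -- unfolding.
  Y : Fin n × Fin n → ℚ
  Y (v , w) = ((+ codeg G v w ℤ.- 1ℤ) ℤ.* + wedges G) / 4

  pickPair : (∃ λ u → wedgesAt G u > 0) → Dist ℚ
  pickPair (u , wedgesAt>0) =
    uniform (distinctPairs (Γ G u)) (distinctPairs>0 (Γ G u) wedgesAt>0) >>= λ vw → return (Y vw)

  𝔼-pickPair : ∀ u wedgesAt>0 →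
               (+ wedgesAt G u / wedges G) * 𝔼 (pickPair (u , wedgesAt>0)) ≡ + β-sum G u / 8
  𝔼-pickPair u wedgesAt>0 =
    *-𝔼-uniform 8 p pairs pairs>0 (λ vw → return (Y vw)) (λ (v , w) → codeg G v w ∸ 1)
      -- `all-filter` recovers that listed pairs are neighbours of `u`, which `codeg>0` requires.
      (All.map (λ {vw} → eachPair vw) (all-filter (distinctIn? (Γ G u)) (vertexPairs n)))
    where
    p       = + wedgesAt G u / wedges G
    pairs   = distinctPairs (Γ G u)
    pairs>0 = distinctPairs>0 (Γ G u) wedgesAt>0

    instance _ = >-nonZero pairs>0

    eachPair : ∀ ((v , w) : Fin n × Fin n) → DistinctIn (Γ G u) (v , w) →
               p * ((+ 1 / length pairs) * 𝔼 (return (Y (v , w)))) ≡ + (codeg G v w ∸ 1) / 8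
    eachPair (v , w) (v∈Γu , w∈Γu , _) = trans
      (cong (λ y → p * ((+ 1 / length pairs) * y)) (𝔼-return (Y (v , w))))
      (weight-cancel (wedgesAt G u) (wedges G) (length pairs) (codeg G v w)
         (length-distinctPairs-Γ G u) (codeg>0 G v∈Γu w∈Γu))
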